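{- Let $G$ be a graph with at least one edge and of diameter at most $3$, and let $j\ge 2$ be an integer. Then $\nu(G)=\nu_{d,j}(G)$ if and only if there exists a vertex $v$ of $G$ such that $G-v$ contains at least $j$ non-trivial connected components and $\nu(G)=\nu(G-v)$.
   Context: All graphs are finite, simple and undirected; the diameter is defined for connected graphs only, so a graph of diameter at most $3$ is connected. A connected component is non-trivial if it contains at least one edge (equivalently, at least two vertices). For a matching $M$ of $G$, $G[M]$ denotes the subgraph of $G$ induced by the set $V(M)$ of endpoints of edges of $M$. $\nu(G)$ is the maximum size of a matching. For an integer $c\ge 1$, a matching $M$ is $c$-disconnected if $G[M]$ has at least $c$ connected components; by convention the empty matching is $c$-disconnected for every $c$. $\nu_{d,c}(G)$ is the maximum size of a $c$-disconnected matching of $G$. -}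

module Defs where

open import Data.Fin using (Fin; zero; suc)
open import Data.Fin.Properties as Fin using (any?; all?; injective⇒≤)
open import Data.Fin.Subset using (Subset; _∈_; _∩_; _∪_; ∁; ⁅_⁆; ⋃; _⊆_; Nonempty)
open import Data.Fin.Subset.Properties using (_∈?_; _⊆?_; nonempty?; anySubset?; x∈p∩q⁺)
import Data.Bool.Properties as Bool
open import Data.List using (List; []; _∷_; map; length; lookup; allFin)
open import Data.List.Properties using (length-map)
import Data.List.Membership.Propositional as L
open import Data.List.Membership.Propositional.Properties using (∈-allFin; ∈-lookup)
open import Data.List.Relation.Unary.All as All using (All)
open import Data.List.Relation.Unary.AllPairs as AllPairs using (AllPairs; allPairs?)
import Data.List.Relation.Unary.AllPairs.Properties as AllPairs
open import Data.List.Relation.Unary.Any using (here; there)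
open import Data.List.Relation.Unary.Unique.Propositional using (Unique)
open import Data.Nat using (ℕ; zero; suc; _≤_)
import Data.Nat.Properties as ℕ
open import Data.Product using (∃; ∃₂; _×_; _,_; proj₁; proj₂)
open import Data.Sum using (_⊎_; inj₁; inj₂)
open import Data.Vec.Properties using (≡-dec)
open import Function.Definitions using (Injective)
open import Function using (_⇔_; mk⇔; _∘_; Equivalence)
open import Level using (0ℓ)
open import Relation.Binary using (Rel; Decidable; Symmetric; Irreflexive)
open import Relation.Binary.Construct.Closure.ReflexiveTransitive as Star
  using (Star; ε; _◅_; _◅◅_)
open import Relation.Binary.PropositionalEquality
  using (_≡_; _≢_; refl; sym; cong; subst)
open import Relation.Nullary using (Dec; yes; no; ¬?; contradiction)
open import Relation.Nullary.Decidable as Dec using (_×-dec_; _⊎-dec_; _→-dec_)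
import Relation.Unary as U

private
  variable
    n : ℕ

IsLeast : (ℕ → Set) → ℕ → Set
IsLeast P k = P k × (∀ m → P m → k ≤ m)

IsGreatest : (ℕ → Set) → ℕ → Set
IsGreatest P k = P k × (∀ m → P m → m ≤ k)

-- The greatest k ≤ b satisfying P, or 0 if there is none.
greatest : {P : ℕ → Set} → U.Decidable P → ℕ → ℕ
greatest P? zero = zero
greatest P? (suc b) with P? (suc b)
... | yes _ = suc b
... | no  _ = greatest P? b

greatest-isGreatest : {P : ℕ → Set} (P? : U.Decidable P) (b : ℕ) →
                      P 0 → (∀ m → P m → m ≤ b) → IsGreatest P (greatest P? b)
greatest-isGreatest P? zero p₀ P≤b = p₀ , P≤b
greatest-isGreatest {P} P? (suc b) p₀ P≤b with P? (suc b)
... | yes p = p , P≤b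
... | no ¬p = greatest-isGreatest P? b p₀ λ m pm →
  ℕ.≤-pred (ℕ.≤∧≢⇒< (P≤b m pm) λ { refl → ¬p pm })

lookup-injective : {A : Set} {xs : List A} → Unique xs →
                   Injective _≡_ _≡_ (lookup xs)
lookup-injective (_ AllPairs.∷ _) {zero}  {zero}  _  = refl
lookup-injective (p AllPairs.∷ _) {zero}  {suc j} eq =
  contradiction eq (All.lookup p (∈-lookup j))
lookup-injective (p AllPairs.∷ _) {suc i} {zero}  eq =
  contradiction (sym eq) (All.lookup p (∈-lookup i))
lookup-injective (_ AllPairs.∷ u) {suc i} {suc j} eq =
  cong suc (lookup-injective u eq)

-- A finite simple graph whose vertex set V is a subset of Fin n, so that
-- induced subgraphs live over the same Fin n.
record Graph (n : ℕ) : Set₁ where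
  infix 4 _∼_ _∼?_
  field
    V      : Subset n
    _∼_    : Rel (Fin n) 0ℓ
    _∼?_   : Decidable _∼_
    ∼⇒∈V   : ∀ {u v} → u ∼ v → u ∈ V
    ∼-sym  : Symmetric _∼_
    ∼-irrefl : Irreflexive _≡_ _∼_

infix 8 _[_] _-_

_[_] : Graph n → Subset n → Graph n
G [ S ] = record
  { V        = V ∩ S
  ; _∼_      = λ u v → u ∈ S × v ∈ S × u ∼ v
  ; _∼?_     = λ u v → (u ∈? S) ×-dec (v ∈? S) ×-dec (u ∼? v)
  ; ∼⇒∈V     = λ (u∈S , _ , u∼v) → x∈p∩q⁺ (∼⇒∈V u∼v , u∈S)
  ; ∼-sym    = λ (u∈S , v∈S , u∼v) → v∈S , u∈S , ∼-sym u∼v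
  ; ∼-irrefl = λ eq (_ , _ , u∼v) → ∼-irrefl eq u∼v
  }
  where open Graph G

_-_ : Graph n → Fin n → Graph n
G - v = G [ ∁ ⁅ v ⁆ ]

HasEdge : Graph n → Set
HasEdge G = ∃₂ λ u v → u ∼ v
  where open Graph G

Walk : Graph n → Rel (Fin n) 0ℓ
Walk G = Star (Graph._∼_ G)

walkLength : (G : Graph n) {u v : Fin n} → Walk G u v → ℕ
walkLength G = Star.fold (λ _ _ → ℕ) (λ _ → suc) 0

IsDistance : (G : Graph n) → Fin n → Fin n → ℕ → Set
IsDistance G u v = IsLeast λ k → ∃ λ (w : Walk G u v) → walkLength G w ≡ k

Connected : Graph n → Set
Connected G = ∀ u v → u ∈ V → v ∈ V → Walk G u v
  where open Graph G

IsDiameter : Graph n → ℕ → Set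
IsDiameter G d =
  Connected G ×
  IsGreatest (λ k → ∃₂ λ u v → u ∈ V × v ∈ V × IsDistance G u v k) d
  where open Graph G

DiameterAtMost : ℕ → Graph n → Set
DiameterAtMost k G = ∃ λ d → IsDiameter G d × d ≤ k

-- Vertex sets of connected components: the classes of the relation
-- "joined by a walk" on V.
IsComponent : Graph n → Subset n → Set
IsComponent G C =
  Nonempty C × C ⊆ V × (∀ u → u ∈ C → ∀ v → v ∈ C ⇔ Walk G u v)
  where open Graph G

NonTrivial : Graph n → Subset n → Set
NonTrivial G C = ∃₂ λ u v → u ∈ C × v ∈ C × u ∼ v
  where open Graph G

AtLeast : {A : Set} → ℕ → (A → Set) → Set
AtLeast c P = ∃ λ xs → length xs ≡ c × Unique xs × All P xs

Disjoint : Rel (Fin n × Fin n) 0ℓ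
Disjoint (a , b) (c , d) = a ≢ c × a ≢ d × b ≢ c × b ≢ d

-- A matching is given by a list of its edges, each as a pair of endpoints.
-- Pairwise disjointness excludes repetitions, so its size is the length.
IsMatching : Graph n → List (Fin n × Fin n) → Set
IsMatching G M = All (λ (u , v) → u ∼ v) M × AllPairs Disjoint M
  where open Graph G

endpoints : List (Fin n × Fin n) → Subset n
endpoints M = ⋃ (map (λ (u , v) → ⁅ u ⁆ ∪ ⁅ v ⁆) M)

IsDisconnected : Graph n → ℕ → List (Fin n × Fin n) → Set
IsDisconnected G c M = M ≡ [] ⊎ AtLeast c (IsComponent (G [ endpoints M ]))

HasMatching : Graph n → ℕ → Set
HasMatching G k = ∃ λ M → length M ≡ k × IsMatching G M

HasDisconnectedMatching : Graph n → ℕ → ℕ → Set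
HasDisconnectedMatching G c k =
  ∃ λ M → length M ≡ k × IsMatching G M × IsDisconnected G c M

module _ {A : Set} (search : {P : A → Set} → U.Decidable P → Dec (∃ P)) where

  anyList? : {P : List A → Set} → U.Decidable P →
             ∀ k → Dec (∃ λ xs → length xs ≡ k × P xs)
  anyList? P? zero =
    Dec.map′ (λ p → [] , refl , p) (λ { ([] , refl , p) → p }) (P? [])
  anyList? P? (suc k) =
    Dec.map′ (λ (x , xs , eq , p) → x ∷ xs , cong suc eq , p)
             (λ { (x ∷ xs , refl , p) → x , xs , refl , p })
             (search λ x → anyList? (P? ∘ (x ∷_)) k)

anyPair? : {P : Fin n × Fin n → Set} → U.Decidable P → Dec (∃ P)
anyPair? P? =
  Dec.map′ (λ (u , v , p) → (u , v) , p) (λ ((u , v) , p) → u , v , p)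
           (any? λ u → any? λ v → P? (u , v))

-- Walk is decided by the Floyd–Warshall recursion: Via xs u v holds when
-- v can be reached from u with all intermediate vertices in xs.
module _ (G : Graph n) where
  open Graph G

  private
    Via : List (Fin n) → Rel (Fin n) 0ℓ
    Via []       u v = u ≡ v ⊎ u ∼ v
    Via (x ∷ xs) u v = Via xs u v ⊎ (Via xs u x × Via xs x v)

    via? : ∀ xs → Decidable (Via xs)
    via? []       u v = (u Fin.≟ v) ⊎-dec (u ∼? v)
    via? (x ∷ xs) u v = via? xs u v ⊎-dec (via? xs u x ×-dec via? xs x v)

    base : ∀ xs {u v} → Via [] u v → Via xs u v
    base []       r = r
    base (_ ∷ xs) r = inj₁ (base xs r)

    via-trans : ∀ xs {u y v} → y L.∈ xs → Via xs u y → Via xs y v → Via xs u v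
    via-trans (x ∷ xs) (here refl) (inj₁ p)       (inj₁ q)       = inj₂ (p , q)
    via-trans (x ∷ xs) (here refl) (inj₁ p)       (inj₂ (_ , q)) = inj₂ (p , q)
    via-trans (x ∷ xs) (here refl) (inj₂ (p , _)) (inj₁ q)       = inj₂ (p , q)
    via-trans (x ∷ xs) (here refl) (inj₂ (p , _)) (inj₂ (_ , q)) = inj₂ (p , q)
    via-trans (x ∷ xs) (there i) (inj₁ p) (inj₁ q) = inj₁ (via-trans xs i p q)
    via-trans (x ∷ xs) (there i) (inj₁ p) (inj₂ (q , r)) =
      inj₂ (via-trans xs i p q , r)
    via-trans (x ∷ xs) (there i) (inj₂ (p , q)) (inj₁ r) =
      inj₂ (p , via-trans xs i q r)
    via-trans (x ∷ xs) (there i) (inj₂ (p , _)) (inj₂ (_ , r)) = inj₂ (p , r)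

    via⇒walk : ∀ xs {u v} → Via xs u v → Walk G u v
    via⇒walk []       (inj₁ refl)    = ε
    via⇒walk []       (inj₂ e)       = e ◅ ε
    via⇒walk (x ∷ xs) (inj₁ p)       = via⇒walk xs p
    via⇒walk (x ∷ xs) (inj₂ (p , q)) = via⇒walk xs p ◅◅ via⇒walk xs q

    walk⇒via : ∀ {u v} → Walk G u v → Via (allFin n) u v
    walk⇒via ε       = base (allFin n) (inj₁ refl)
    walk⇒via (e ◅ w) =
      via-trans (allFin n) (∈-allFin _) (base (allFin n) (inj₂ e)) (walk⇒via w)

  walk? : Decidable (Walk G)
  walk? u v = Dec.map′ (via⇒walk (allFin n)) walk⇒via (via? (allFin n) u v)

  isComponent? : U.Decidable (IsComponent G)
  isComponent? C =
    nonempty? C ×-dec (C ⊆? V) ×-dec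
    all? λ u → (u ∈? C) →-dec all? λ v →
      Dec.map′ (λ (f , g) → mk⇔ f g) (λ e → Equivalence.to e , Equivalence.from e)
        (((v ∈? C) →-dec walk? u v) ×-dec (walk? u v →-dec (v ∈? C)))

  isMatching? : U.Decidable (IsMatching G)
  isMatching? M =
    All.all? (λ (u , v) → u ∼? v) M ×-dec
    allPairs? (λ (a , b) (c , d) → ¬? (a Fin.≟ c) ×-dec ¬? (a Fin.≟ d) ×-dec
                                   ¬? (b Fin.≟ c) ×-dec ¬? (b Fin.≟ d)) M

  hasMatching? : U.Decidable (HasMatching G)
  hasMatching? = anyList? anyPair? isMatching?

  matching-length : ∀ M → IsMatching G M → length M ≤ n
  matching-length M (_ , disjoint) =
    subst (_≤ n) (length-map proj₁ M)
      (injective⇒≤ (lookup-injective (AllPairs.map⁺ (AllPairs.map proj₁ disjoint))))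

isDisconnected? : (G : Graph n) (c : ℕ) → U.Decidable (IsDisconnected G c)
isDisconnected? G c M =
  isEmpty? M ⊎-dec
  anyList? anySubset?
    (λ Cs → allPairs? (λ C D → ¬? (≡-dec Bool._≟_ C D)) Cs ×-dec
            All.all? (isComponent? (G [ endpoints M ])) Cs) c
  where
  isEmpty? : ∀ {A : Set} (xs : List A) → Dec (xs ≡ [])
  isEmpty? []      = yes refl
  isEmpty? (_ ∷ _) = no λ ()

hasDisconnectedMatching? : (G : Graph n) (c : ℕ) →
                           U.Decidable (HasDisconnectedMatching G c)
hasDisconnectedMatching? G c =
  anyList? anyPair? (λ M → isMatching? G M ×-dec isDisconnected? G c M)

ν : Graph n → ℕ
ν {n} G = greatest (hasMatching? G) n

νd : Graph n → ℕ → ℕ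
νd {n} G c = greatest (hasDisconnectedMatching? G c) n

ν-isGreatest : (G : Graph n) → IsGreatest (HasMatching G) (ν G)
ν-isGreatest {n} G = greatest-isGreatest (hasMatching? G) n
  ([] , refl , All.[] , AllPairs.[])
  (λ { _ (M , refl , m) → matching-length G M m })

νd-isGreatest : (G : Graph n) (c : ℕ) →
                IsGreatest (HasDisconnectedMatching G c) (νd G c)
νd-isGreatest {n} G c = greatest-isGreatest (hasDisconnectedMatching? G c) n
  ([] , refl , (All.[] , AllPairs.[]) , inj₁ refl)
  (λ { _ (M , refl , m , _) → matching-length G M m })

{-# OPTIONS --safe #-}

-- (⇒) Let M be a maximum matching such that G[M] is disconnected, and let S be its
-- set of endpoints.  No edge avoids S, so a path of length at most 3 between two
-- components of G[M] leaves S exactly once, next to one of its ends.  Hence all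
-- vertices of S without a neighbour outside S lie in a single component; call the
-- other components good.  As there are no augmenting paths of length 3 or 5, all
-- vertices of a good component have the same single neighbour outside S, and paths
-- of length at most 3 show that this apex v is the same for all good components.
-- So in G - v every good component is separated from the rest of S, and distinct
-- components of G[M] stay disconnected.
--
-- (⇐) By maximality, a maximum matching of G - v meets every non-trivial component
-- of G - v.
module Submission where

open import Data.Bool using (true)
open import Data.Fin using (Fin; _≟_)
open import Data.Fin.Properties using (any?)
open import Data.Fin.Subset using (Subset; _∈_; _∉_)
open import Data.Fin.Subset.Properties
  using (_∈?_; ⊆-antisym; ∉⊥; x∈⁅x⁆; x∈⁅y⁆⇒x≡y; x≢y⇒x∉⁅y⁆; x∉⁅y⁆⇒x≢y;
         x∉p⇒x∈∁p; x∈∁p⇒x∉p; x∈p∩q⁺; x∈p∩q⁻; x∈p∪q⁺; x∈p∪q⁻)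
open import Data.List using (List; []; _∷_; map; length)
open import Data.List.Properties using (length-map)
import Data.List.Membership.Propositional as L
open import Data.List.Membership.Propositional.Properties using (∈-∃++)
open import Data.List.Relation.Binary.Permutation.Propositional using (↭⇒↭ₛ)
open import Data.List.Relation.Binary.Permutation.Propositional.Properties
  using (shift; ↭-length; All-resp-↭; ∈-resp-↭)
import Data.List.Relation.Binary.Permutation.Setoid.Properties as Permutation
open import Data.List.Relation.Binary.Pointwise using (Pointwise; []; _∷_; Pointwise-length)
open import Data.List.Relation.Unary.All as All using (All; []; _∷_)
open import Data.List.Relation.Unary.AllPairs as AllPairs using (AllPairs; []; _∷_)
import Data.List.Relation.Unary.AllPairs.Properties as AllPairs
open import Data.List.Relation.Unary.Any using (here; there)
open import Data.List.Relation.Unary.Unique.Propositional using (Unique)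
open import Data.Nat using (ℕ; zero; suc; _≤_; z≤n; s≤s)
import Data.Nat.Properties as ℕ
open import Data.Product using (∃; ∃₂; _×_; _,_; proj₁; proj₂)
open import Data.Sum using (_⊎_; inj₁; inj₂; swap)
open import Data.Vec using (tabulate)
open import Data.Vec.Properties using (lookup∘tabulate; lookup⇒[]=; []=⇒lookup)
open import Function using (_⇔_; mk⇔; _∘_; Equivalence)
open import Relation.Binary using (Decidable)
open import Relation.Binary.Construct.Closure.ReflexiveTransitive as Star
  using (ε; _◅_; _◅◅_)
open import Relation.Binary.PropositionalEquality
  using (_≡_; _≢_; refl; sym; trans; cong; subst; setoid; resp₂; ≢-sym)
open import Relation.Nullary using (¬_; Dec; yes; no; ¬?; contradiction; does)
open import Relation.Nullary.Decidable as Dec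
  using (_×-dec_; decidable-stable; dec-true)
import Relation.Unary as U
open import Defs

private
  variable
    n : ℕ

-- Walks, distances and components.

least : {P : ℕ → Set} → U.Decidable P → ∀ k → P k → ∃ (IsLeast P)
least P? zero p = 0 , p , λ _ _ → z≤n
least P? (suc k) p with P? 0
... | yes p₀ = 0 , p₀ , λ _ _ → z≤n
... | no ¬p₀ = let m , pm , m≤ = least (P? ∘ suc) k p in
  suc m , pm , λ { zero p₀ → contradiction p₀ ¬p₀ ; (suc i) pi → s≤s (m≤ i pi) }

does-true⁻ : {A : Set} (a? : Dec A) → does a? ≡ true → A
does-true⁻ (yes a) _ = a

module _ (H : Graph n) where
  open Graph H

  walk-sym : ∀ {u v} → Walk H u v → Walk H v u
  walk-sym = Star.reverse ∼-sym

  walk-∈V : ∀ {u v} → Walk H u v → u ∈ V → v ∈ V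
  walk-∈V ε       u∈V = u∈V
  walk-∈V (e ◅ w) _   = walk-∈V w (∼⇒∈V (∼-sym e))

  walkOfLength? : ∀ k → Decidable (λ u v → ∃ λ (w : Walk H u v) → walkLength H w ≡ k)
  walkOfLength? zero u v =
    Dec.map′ (λ { refl → ε , refl }) (λ { (ε , _) → refl }) (u ≟ v)
  walkOfLength? (suc k) u v =
    Dec.map′ (λ (_ , e , w , eq) → e ◅ w , cong suc eq)
             (λ { (e ◅ w , eq) → _ , e , w , ℕ.suc-injective eq })
             (any? λ x → (u ∼? x) ×-dec walkOfLength? k x v)

  -- The diameter bounds distances only, so a distance has to be exhibited first: `least` searches
  -- up to the length of a walk given by connectedness.
  shortWalk : ∀ {k} → DiameterAtMost k H → ∀ {u v} → u ∈ V → v ∈ V →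
              ∃ λ (w : Walk H u v) → walkLength H w ≤ k
  shortWalk (_ , (connected , _ , maximal) , d≤k) {u} {v} u∈V v∈V =
    let w , eq = proj₁ distance in w , ℕ.≤-trans (ℕ.≤-reflexive eq)
      (ℕ.≤-trans (maximal _ (u , v , u∈V , v∈V , distance)) d≤k)
    where
    distance = proj₂ (least (λ k → walkOfLength? k u v) _ (connected u v u∈V v∈V , refl))

  component : Fin n → Subset n
  component x = tabulate (does ∘ walk? H x)

  ∈-component⁺ : ∀ {x y} → Walk H x y → y ∈ component x
  ∈-component⁺ {x} {y} w = lookup⇒[]= y _
    (trans (lookup∘tabulate _ y) (dec-true (walk? H x y) w))

  ∈-component⁻ : ∀ {x y} → y ∈ component x → Walk H x y
  ∈-component⁻ {x} {y} y∈ = does-true⁻ (walk? H x y)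
    (trans (sym (lookup∘tabulate (does ∘ walk? H x) y)) ([]=⇒lookup y∈))

  component-isComponent : ∀ {x} → x ∈ V → IsComponent H (component x)
  component-isComponent x∈V =
    (_ , ∈-component⁺ ε) , (λ y∈ → walk-∈V (∈-component⁻ y∈) x∈V) ,
    λ u u∈ v → mk⇔ (λ v∈ → walk-sym (∈-component⁻ u∈) ◅◅ ∈-component⁻ v∈)
                   (λ w → ∈-component⁺ (∈-component⁻ u∈ ◅◅ w))

  components-meeting : ∀ {C D z} → IsComponent H C → IsComponent H D →
                       z ∈ C → z ∈ D → C ≡ D
  components-meeting (_ , _ , c) (_ , _ , d) z∈C z∈D = ⊆-antisym
    (λ x∈C → Equivalence.from (d _ z∈D _) (Equivalence.to (c _ z∈C _) x∈C))
    (λ x∈D → Equivalence.from (c _ z∈C _) (Equivalence.to (d _ z∈D _) x∈D))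

-- Each component of `H` is given a representative in `T` and replaced by the component of that
-- vertex in `K`. Distinctness survives because a `K`-walk between representatives yields an
-- `H`-walk. Both directions of the theorem use this, with `G - v` and the matched subgraph
-- exchanging roles.
transferComponents : (H K : Graph n) (T : Fin n → Set) {P Q : Subset n → Set} →
  (∀ {C} → P C → IsComponent H C) →
  (∀ {C} → P C → ∃ λ z → z ∈ C × T z) →
  (∀ {z} → T z → Q (component K z)) →
  (∀ {y z} → T y → T z → Walk K y z → Walk H y z) →
  ∀ {c} → AtLeast c P → AtLeast c Q
transferComponents {n} H K T {P} {Q} isComp meets good walk (Cs , refl , unique , ps) =
  let zs , pw = representatives ps in
  map (component K) zs ,
  trans (length-map (component K) zs) (sym (Pointwise-length pw)) ,
  AllPairs.map⁺ (distinct unique pw) , allGood pw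
  where
  _Represents_ : Subset n → Fin n → Set
  C Represents z = P C × z ∈ C × T z

  representatives : ∀ {Cs} → All P Cs → ∃ (Pointwise _Represents_ Cs)
  representatives [] = [] , []
  representatives (p ∷ ps) =
    let z , z∈C , t = meets p ; zs , pw = representatives ps in
    z ∷ zs , (p , z∈C , t) ∷ pw

  allGood : ∀ {Cs zs} → Pointwise _Represents_ Cs zs → All Q (map (component K) zs)
  allGood []                   = []
  allGood ((_ , _ , t) ∷ pw) = good t ∷ allGood pw

  separate : ∀ {C D y z} → C ≢ D → C Represents y → D Represents z →
             component K y ≢ component K z
  separate C≢D (p , y∈C , ty) (q , z∈D , tz) eq = C≢D
    (components-meeting H (isComp p) (isComp q)
      (Equivalence.from (proj₂ (proj₂ (isComp p)) _ y∈C _)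
        (walk ty tz (∈-component⁻ K (subst (_ ∈_) (sym eq) (∈-component⁺ K ε)))))
      z∈D)

  distinct : ∀ {Cs zs} → Unique Cs → Pointwise _Represents_ Cs zs →
             AllPairs (λ y z → component K y ≢ component K z) zs
  distinct []             []         = []
  distinct (C∉ ∷ unique) (r ∷ pw) = head C∉ pw ∷ distinct unique pw
    where
    head : ∀ {Ds zs} → All (_ ≢_) Ds → Pointwise _Represents_ Ds zs →
           All (λ z → component K _ ≢ component K z) zs
    head []           []         = []
    head (C≢D ∷ C∉) (s ∷ pw) = separate C≢D r s ∷ head C∉ pw

-- Matchings as edge lists.

-- Edges are stored as ordered pairs, so both orientations count.
Mates : List (Fin n × Fin n) → Fin n → Fin n → Set
Mates M x y = (x , y) L.∈ M ⊎ (y , x) L.∈ M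

-- Kept in the shape of the `Disjoint` conditions, so that edges can be added and removed one at a
-- time.
Fresh : Fin n → List (Fin n × Fin n) → Set
Fresh x = All λ (c , d) → x ≢ c × x ≢ d

mates-∈ˡ : ∀ {M : List (Fin n × Fin n)} {x y} → Mates M x y → x ∈ endpoints M
mates-∈ˡ {M = (c , d) ∷ M} (inj₁ (here refl)) = x∈p∪q⁺ (inj₁ (x∈p∪q⁺ (inj₁ (x∈⁅x⁆ c))))
mates-∈ˡ {M = (c , d) ∷ M} (inj₂ (here refl)) = x∈p∪q⁺ (inj₁ (x∈p∪q⁺ (inj₂ (x∈⁅x⁆ d))))
mates-∈ˡ {M = _ ∷ M} (inj₁ (there i)) = x∈p∪q⁺ (inj₂ (mates-∈ˡ {M = M} (inj₁ i)))
mates-∈ˡ {M = _ ∷ M} (inj₂ (there i)) = x∈p∪q⁺ (inj₂ (mates-∈ˡ {M = M} (inj₂ i)))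

mates-there : ∀ {M : List (Fin n × Fin n)} {e x y} → Mates M x y → Mates (e ∷ M) x y
mates-there (inj₁ i) = inj₁ (there i)
mates-there (inj₂ i) = inj₂ (there i)

mate : ∀ (M : List (Fin n × Fin n)) {x} → x ∈ endpoints M → ∃ (Mates M x)
mate [] x∈ = contradiction x∈ ∉⊥
mate ((c , d) ∷ M) x∈ with x∈p∪q⁻ _ _ x∈
... | inj₂ x∈M = let y , m = mate M x∈M in y , mates-there m
... | inj₁ x∈cd with x∈p∪q⁻ _ _ x∈cd
...   | inj₁ x∈c rewrite x∈⁅y⁆⇒x≡y c x∈c = d , inj₁ (here refl)
...   | inj₂ x∈d rewrite x∈⁅y⁆⇒x≡y d x∈d = c , inj₂ (here refl)

fresh : ∀ (M : List (Fin n × Fin n)) {x} → x ∉ endpoints M → Fresh x M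
fresh M x∉ = All.tabulate λ i →
  (λ { refl → x∉ (mates-∈ˡ (inj₁ i)) }) , (λ { refl → x∉ (mates-∈ˡ (inj₂ i)) })

fresh-mates : ∀ {M : List (Fin n × Fin n)} {x y z} → Fresh z M → Mates M x y → z ≢ x × z ≢ y
fresh-mates f (inj₁ i) = All.lookup f i
fresh-mates f (inj₂ i) = let p , q = All.lookup f i in q , p

module _ (G : Graph n) where
  open Graph G

  matching-∷ : ∀ {a b M} → a ∼ b → Fresh a M → Fresh b M → IsMatching G M →
               IsMatching G ((a , b) ∷ M)
  matching-∷ a∼b fa fb (edges , disjoint) =
    a∼b ∷ edges , All.zipWith (λ ((p , q) , r , s) → p , q , r , s) (fa , fb) ∷ disjoint

  matching-uncons : ∀ {a b M} → IsMatching G ((a , b) ∷ M) →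
                    a ∼ b × Fresh a M × Fresh b M × IsMatching G M
  matching-uncons (a∼b ∷ edges , d ∷ disjoint) =
    a∼b , All.map (λ (p , q , _) → p , q) d , All.map (λ (_ , _ , r , s) → r , s) d ,
    edges , disjoint

  mates-∼ : ∀ {M x y} → IsMatching G M → Mates M x y → x ∼ y
  mates-∼ (edges , _) (inj₁ i) = All.lookup edges i
  mates-∼ (edges , _) (inj₂ i) = ∼-sym (All.lookup edges i)

  -- `rest` is `M` without the edge `x y`. Since moving that edge to the front changes the list,
  -- `freshen` and `rematch` carry facts about `M` over.
  record Extraction (M : List (Fin n × Fin n)) (x y : Fin n) : Set where
    field
      rest     : List (Fin n × Fin n)
      size     : length M ≡ suc (length rest)
      matching : IsMatching G ((x , y) ∷ rest)
      freshen  : ∀ {a} → Fresh a M → Fresh a ((x , y) ∷ rest)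
      rematch  : ∀ {u v} → Mates M u v → Mates ((x , y) ∷ rest) u v

  extract : ∀ {M x y} → IsMatching G M → Mates M x y → Extraction M x y
  extract (edges , disjoint) (inj₁ i) with ∈-∃++ i
  ... | ys , zs , refl = record
    { size     = ↭-length p
    ; matching = All-resp-↭ p edges ,
                 Permutation.AllPairs-resp-↭ (setoid _)
                   -- Symmetry of `Disjoint`: a permutation may reverse the order of two edges.
                   (λ (p , q , r , s) → ≢-sym p , ≢-sym r , ≢-sym q , ≢-sym s)
                   (resp₂ Disjoint) (↭⇒↭ₛ p) disjoint
    ; freshen  = All-resp-↭ p
    ; rematch  = λ { (inj₁ j) → inj₁ (∈-resp-↭ p j) ; (inj₂ j) → inj₂ (∈-resp-↭ p j) }
    }
    where p = shift _ ys zs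
  -- The edge is stored as `(y , x)`; it is extracted in that form and then flipped.
  extract {x = x} {y} m (inj₂ i) = record
    { size     = size
    ; matching = let y∼x , fy , fx , m′ = matching-uncons matching in
                 matching-∷ (∼-sym y∼x) fx fy m′
    ; freshen  = λ f → let p , q = All.head (freshen f) in (q , p) ∷ All.tail (freshen f)
    ; rematch  = flip ∘ rematch
    }
    where
    open Extraction (extract m (inj₁ i))
    flip : ∀ {u v} → Mates ((y , x) ∷ rest) u v → Mates ((x , y) ∷ rest) u v
    flip (inj₁ (here refl)) = inj₂ (here refl)
    flip (inj₂ (here refl)) = inj₁ (here refl)
    flip (inj₁ (there j))   = inj₁ (there j)
    flip (inj₂ (there j))   = inj₂ (there j)

∼-delete : (G : Graph n) → ∀ {u v w} → u ≢ w → v ≢ w → Graph._∼_ G u v → Graph._∼_ (G - w) u v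
∼-delete G u≢w v≢w u∼v =
  x∉p⇒x∈∁p (x≢y⇒x∉⁅y⁆ u≢w) , x∉p⇒x∈∁p (x≢y⇒x∉⁅y⁆ v≢w) , u∼v

-- Maximum matchings and augmenting paths.

module MaximumMatching (G : Graph n) (M : List (Fin n × Fin n))
  (matching : IsMatching G M) (maximum : ∀ N → IsMatching G N → length N ≤ length M) where
  open Graph G

  S : Subset n
  S = endpoints M

  GS : Graph n
  GS = G [ S ]

  _≈_ : Fin n → Fin n → Set
  _≈_ = Walk GS

  ≉S : ∀ {a x} → a ∉ S → x ∈ S → a ≢ x
  ≉S a∉ x∈ refl = a∉ x∈

  ∼⇒≢ : ∀ {x y} → x ∼ y → x ≢ y
  ∼⇒≢ x∼y x≡y = ∼-irrefl x≡y x∼y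

  mates-∈ʳ : ∀ {x y} → Mates M x y → y ∈ S
  mates-∈ʳ m = mates-∈ˡ (swap m)

  -- Such an edge could be added to `M`.
  uncovered-independent : ∀ {a b} → a ∉ S → b ∉ S → ¬ a ∼ b
  uncovered-independent a∉ b∉ a∼b =
    ℕ.1+n≰n (maximum _ (matching-∷ G a∼b (fresh M a∉) (fresh M b∉) matching))

  -- An edge of `C` cannot have both ends uncovered. The direction (⇐) applies this to a maximum
  -- matching of `G - v`.
  nonTrivial-meets : ∀ {C} → IsComponent G C × NonTrivial G C → ∃ λ z → z ∈ C × z ∈ S
  nonTrivial-meets (_ , u , w , u∈C , w∈C , u∼w) with u ∈? S | w ∈? S
  ... | yes u∈ | _      = u , u∈C , u∈
  ... | no _   | yes w∈ = w , w∈C , w∈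
  ... | no u∉  | no w∉  = contradiction u∼w (uncovered-independent u∉ w∉)

  -- Otherwise a, x, x′, b is an augmenting path.
  augment₃ : ∀ {a b x x′} → a ∉ S → b ∉ S → x ∼ a → Mates M x x′ → x′ ∼ b → a ≡ b
  augment₃ {a} {b} {x} {x′} a∉ b∉ x∼a m x′∼b = decidable-stable (a ≟ b) λ a≢b →
    let
      open Extraction (extract G matching m) using (size; freshen) renaming (matching to matching′)
      x∼x′ , fx , fx′ , m′ = matching-uncons G matching′
    in
    ℕ.1+n≰n (ℕ.≤-trans (maximum _
      (matching-∷ G (∼-sym x∼a)
        ((≉S a∉ (mates-∈ʳ m) , a≢b) ∷ All.tail (freshen (fresh M a∉)))
        ((∼⇒≢ x∼x′ , ≢-sym (≉S b∉ (mates-∈ˡ m))) ∷ fx)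
        (matching-∷ G x′∼b fx′ (All.tail (freshen (fresh M b∉))) m′)))
      (ℕ.≤-reflexive size))

  -- Otherwise a, x′, x, y, y′, b is an augmenting path.
  augment₅ : ∀ {a b x x′ y y′} → a ∉ S → b ∉ S → x′ ∼ a → Mates M x x′ → x ∼ y →
             y ≢ x′ → Mates M y y′ → y′ ∼ b → a ≡ b
  augment₅ {a} {b} {x} {x′} {y} {y′} a∉ b∉ x′∼a mx x∼y y≢x′ my y′∼b =
    decidable-stable (a ≟ b) λ a≢b →
    let
      module X = Extraction (extract G matching mx)
      _ , fx , fx′ , m′ = matching-uncons G X.matching
      my′ = tail (X.rematch my)
      module Y = Extraction (extract G m′ my′)
      _ , fy , fy′ , m″ = matching-uncons G Y.matching
      a-fresh = All.tail (Y.freshen (All.tail (X.freshen (fresh M a∉))))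
      b-fresh = All.tail (Y.freshen (All.tail (X.freshen (fresh M b∉))))
    in
    ℕ.1+n≰n (ℕ.≤-trans (maximum _
      (matching-∷ G (∼-sym x′∼a)
        ((≉S a∉ (mates-∈ˡ mx) , ≉S a∉ (mates-∈ˡ my)) ∷
         (≉S a∉ (mates-∈ʳ my) , a≢b) ∷ a-fresh)
        ((≢-sym (∼⇒≢ (mates-∼ G matching mx)) , ≢-sym y≢x′) ∷
         (proj₂ (fresh-mates fx′ my′) , ≢-sym (≉S b∉ (mates-∈ʳ mx))) ∷
         All.tail (Y.freshen fx′))
        (matching-∷ G x∼y
          ((proj₂ (fresh-mates fx my′) , ≢-sym (≉S b∉ (mates-∈ˡ mx))) ∷
           All.tail (Y.freshen fx))
          ((∼⇒≢ (mates-∼ G matching my) , ≢-sym (≉S b∉ (mates-∈ˡ my))) ∷ fy)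
          (matching-∷ G y′∼b fy′ b-fresh m″))))
      (ℕ.≤-reflexive (trans X.size (cong suc Y.size))))
    where
    -- `y` is neither `x`, being adjacent to it, nor `x′`, so its matching edge is not the one
    -- already extracted.
    tail : ∀ {N} → Mates ((x , x′) ∷ N) y y′ → Mates N y y′
    tail (inj₁ (here refl)) = contradiction refl (∼⇒≢ x∼y)
    tail (inj₂ (here refl)) = contradiction refl y≢x′
    tail (inj₁ (there i))   = inj₁ i
    tail (inj₂ (there i))   = inj₂ i

  -- Good components and their apex.

  Exits : Fin n → Set
  Exits x = ∃ λ a → a ∉ S × x ∼ a

  exits? : U.Decidable Exits
  exits? x = any? λ a → ¬? (a ∈? S) ×-dec (x ∼? a)

  -- A good component is represented by any of its vertices, which suits induction along walks.
  Good : Fin n → Set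
  Good x = ∀ {z} → x ≈ z → Exits z

  good-≈ : ∀ {x y} → Good x → x ≈ y → Good y
  good-≈ g x≈y y≈z = g (x≈y ◅◅ y≈z)

  ≈-∈ : ∀ {x y} → x ∈ S → x ≈ y → y ∈ S
  ≈-∈ x∈ ε                     = x∈
  ≈-∈ x∈ ((_ , y∈ , _) ◅ y≈z) = ≈-∈ y∈ y≈z

  mates-≈ : ∀ {x y} → Mates M x y → x ≈ y
  mates-≈ m = (mates-∈ˡ m , mates-∈ʳ m , mates-∼ G matching m) ◅ ε

  -- Goodness gives the mate of `x` an outside neighbour `c`, and `augment₃` identifies both `a` and
  -- `b` with `c`.
  apex-unique : ∀ {x a b} → Good x → x ∈ S → a ∉ S → b ∉ S → x ∼ a → x ∼ b → a ≡ b
  apex-unique good x∈ a∉ b∉ x∼a x∼b =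
    let x′ , m = mate M x∈ ; c , c∉ , x′∼c = good (mates-≈ m) in
    trans (augment₃ a∉ c∉ x∼a m x′∼c) (sym (augment₃ b∉ c∉ x∼b m x′∼c))

  -- By induction along the walk, it suffices to pass the apex across one edge `x y` inside `S`. If
  -- `y` is the mate of `x`, `augment₃` does this; otherwise `augment₅` compares the outside
  -- neighbours of the two mates.
  apex-≈ : ∀ {x y a} → Good x → a ∉ S → x ∼ a → x ≈ y → y ∼ a
  apex-≈ good a∉ x∼a ε = x∼a
  apex-≈ {a = a} good a∉ x∼a (_◅_ {j = y} e@(x∈ , y∈ , x∼y) y≈z) =
    apex-≈ (good-≈ good (e ◅ ε)) a∉ step y≈z
    where
    step : y ∼ a
    step with mate M x∈ | mate M y∈
    ... | x′ , mx | y′ , my with good (mates-≈ mx) | good (e ◅ ε) | good (e ◅ mates-≈ my)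
    ...   | c , c∉ , x′∼c | d , d∉ , y∼d | f , f∉ , y′∼f
      -- The ends of each matching edge share their outside neighbour: `c` is `a`, and `f` is `d`.
      with augment₃ a∉ c∉ x∼a mx x′∼c | augment₃ d∉ f∉ y∼d my y′∼f | y ≟ x′
    ...     | refl | refl | yes refl = x′∼c
    ...     | refl | refl | no y≢x′ =
      subst (y ∼_) (sym (augment₅ a∉ f∉ x′∼c mx x∼y y≢x′ my y′∼f)) y∼d

  -- Consequences of diameter at most 3.

  -- The outside vertex is next to the first argument, so the relation need not be symmetric and
  -- `crossing` offers both orders.
  Crosses : Fin n → Fin n → Set
  Crosses x y = ∃₂ λ a p → a ∉ S × x ∼ a × a ∼ p × p ≈ y

  module _ (diameter : DiameterAtMost 3 G) where

    -- Cases on a walk with at most three edges. With three, exactly one inner vertex is outside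
    -- `S`: two inside would give `x ≈ y`, two outside an uncovered edge.
    crossing : ∀ {x y} → x ∈ S → y ∈ S → ¬ x ≈ y → Crosses x y ⊎ Crosses y x
    crossing {x} {y} x∈ y∈ x≉y
      with shortWalk G diameter (∼⇒∈V (mates-∼ G matching (proj₂ (mate M x∈))))
                                (∼⇒∈V (mates-∼ G matching (proj₂ (mate M y∈))))
    ... | ε , _ = contradiction ε x≉y
    ... | x∼y ◅ ε , _ = contradiction ((x∈ , y∈ , x∼y) ◅ ε) x≉y
    ... | _◅_ {j = a} x∼a (a∼y ◅ ε) , _ with a ∈? S
    ...   | yes a∈ = contradiction ((x∈ , a∈ , x∼a) ◅ (a∈ , y∈ , a∼y) ◅ ε) x≉y
    ...   | no a∉  = inj₁ (a , y , a∉ , x∼a , a∼y , ε)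
    crossing {x} {y} x∈ y∈ x≉y
        | _◅_ {j = a} x∼a (_◅_ {j = b} a∼b (b∼y ◅ ε)) , _ with a ∈? S | b ∈? S
    ...   | yes a∈ | yes b∈ =
      contradiction ((x∈ , a∈ , x∼a) ◅ (a∈ , b∈ , a∼b) ◅ (b∈ , y∈ , b∼y) ◅ ε) x≉y
    ...   | yes a∈ | no b∉ =
      inj₂ (b , a , b∉ , ∼-sym b∼y , ∼-sym a∼b , (a∈ , x∈ , ∼-sym x∼a) ◅ ε)
    ...   | no a∉ | yes b∈ = inj₁ (a , b , a∉ , x∼a , a∼b , (b∈ , y∈ , b∼y) ◅ ε)
    ...   | no a∉ | no b∉ = contradiction a∼b (uncovered-independent a∉ b∉)
    crossing _ _ _ | _ ◅ _ ◅ _ ◅ _ ◅ _ , s≤s (s≤s (s≤s ()))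

    -- A crossing in either order would give its first end a neighbour outside `S`.
    nonExits-≈ : ∀ {x y} → x ∈ S → y ∈ S → ¬ Exits x → ¬ Exits y → x ≈ y
    nonExits-≈ {x} {y} x∈ y∈ ¬x ¬y = decidable-stable (walk? GS x y) λ x≉y →
      case (crossing x∈ y∈ x≉y)
      where
      case : ¬ (Crosses x y ⊎ Crosses y x)
      case (inj₁ (a , _ , a∉ , x∼a , _)) = ¬x (a , a∉ , x∼a)
      case (inj₂ (a , _ , a∉ , y∼a , _)) = ¬y (a , a∉ , y∼a)

    good⊎nonExit : ∀ x → Good x ⊎ ∃ λ z → x ≈ z × ¬ Exits z
    good⊎nonExit x with any? (λ z → walk? GS x z ×-dec ¬? (exits? z))
    ... | yes bad = inj₂ bad
    ... | no ¬bad = inj₁ λ {z} x≈z → decidable-stable (exits? z) λ ¬z → ¬bad (z , x≈z , ¬z)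

    -- Two components that are not good would contain vertices without exits, which `nonExits-≈`
    -- joins.
    good-≉ : ∀ {x y} → x ∈ S → y ∈ S → ¬ x ≈ y → Good x ⊎ Good y
    good-≉ {x} {y} x∈ y∈ x≉y with good⊎nonExit x | good⊎nonExit y
    ... | inj₁ gx | _       = inj₁ gx
    ... | inj₂ _  | inj₁ gy = inj₂ gy
    ... | inj₂ (w , x≈w , ¬w) | inj₂ (z , y≈z , ¬z) = contradiction
      (x≈w ◅◅ nonExits-≈ (≈-∈ x∈ x≈w) (≈-∈ y∈ y≈z) ¬w ¬z ◅◅ walk-sym GS y≈z) x≉y

    -- Deletion of the common apex.

    module Apex {x₀ v} (x₀∈ : x₀ ∈ S) (good₀ : Good x₀) (v∉ : v ∉ S) (x₀∼v : x₀ ∼ v) where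

      -- A crossing between the components of `x₀` and `y` runs through an outside vertex adjacent
      -- to both. `apex-unique`, applied on the side of `x₀`, shows that this vertex is `v`.
      good-apex : ∀ {y} → y ∈ S → Good y → y ∼ v
      good-apex {y} y∈ good with walk? GS x₀ y
      ... | yes x₀≈y = apex-≈ good₀ v∉ x₀∼v x₀≈y
      ... | no x₀≉y with crossing x₀∈ y∈ x₀≉y
      ...   | inj₁ (a , p , a∉ , x₀∼a , a∼p , p≈y) =
        apex-≈ (good-≈ good (walk-sym GS p≈y)) v∉
          (subst (p ∼_) (apex-unique good₀ x₀∈ a∉ v∉ x₀∼a x₀∼v) (∼-sym a∼p)) p≈y
      ...   | inj₂ (a , p , a∉ , y∼a , a∼p , p≈x₀) =
        let x₀≈p = walk-sym GS p≈x₀ in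
        subst (y ∼_)
          (apex-unique (good-≈ good₀ x₀≈p) (≈-∈ x₀∈ x₀≈p) a∉ v∉ (∼-sym a∼p)
            (apex-≈ good₀ v∉ x₀∼v x₀≈p))
          y∼a

      -- A first step out of `S` could only lead to the apex `v`, which is deleted.
      good-isolated : ∀ {x z} → x ∈ S → Good x → Walk (G - v) x z → x ≈ z
      good-isolated x∈ good ε = ε
      good-isolated {x} x∈ good (_◅_ {j = y} (_ , y∈∁v , x∼y) w) with y ∈? S
      ... | yes y∈ = let e = x∈ , y∈ , x∼y in
        e ◅ good-isolated y∈ (good-≈ good (e ◅ ε)) w
      ... | no y∉ = contradiction
        (apex-unique good x∈ y∉ v∉ x∼y (good-apex x∈ good))
        (x∉⁅y⁆⇒x≢y (x∈∁p⇒x∉p y∈∁v))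

      -- If the ends lay in different components, one of them would be good, and `good-isolated`
      -- applies from that end.
      separated : ∀ {x y} → x ∈ S → y ∈ S → Walk (G - v) x y → x ≈ y
      separated {x} {y} x∈ y∈ w = decidable-stable (walk? GS x y) λ x≉y →
        case x≉y (good-≉ x∈ y∈ x≉y)
        where
        case : ¬ x ≈ y → ¬ (Good x ⊎ Good y)
        case x≉y (inj₁ gx) = x≉y (good-isolated x∈ gx w)
        case x≉y (inj₂ gy) = x≉y (walk-sym GS (good-isolated y∈ gy (walk-sym (G - v) w)))

    componentMeets : ∀ {C} → IsComponent GS C → ∃ λ z → z ∈ C × z ∈ S
    componentMeets ((z , z∈C) , C⊆ , _) = z , z∈C , proj₂ (x∈p∩q⁻ V S (C⊆ z∈C))

    -- Since `2 ≤ j`, there are two distinct components, one of them good by `good-≉`; its apex is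
    -- the required `v`.
    separatingVertex : ∀ {j} → 2 ≤ j → AtLeast j (IsComponent GS) →
      ∃ λ v → v ∈ V × v ∉ S ×
        AtLeast j (λ C → IsComponent (G - v) C × NonTrivial (G - v) C)
    separatingVertex 2≤j ([] , refl , _) = contradiction 2≤j λ ()
    separatingVertex 2≤j (_ ∷ [] , refl , _) = contradiction 2≤j λ { (s≤s ()) }
    separatingVertex _ comps@(_ ∷ _ ∷ _ , _ , (C≢D ∷ _) ∷ _ , c ∷ d ∷ _) =
      let x , x∈C , x∈ = componentMeets c
          y , y∈D , y∈ = componentMeets d
          z , z∈ , good = pick x∈ y∈ λ x≈y → C≢D
            (components-meeting GS c d (Equivalence.from (proj₂ (proj₂ c) x x∈C y) x≈y) y∈D)
          v , v∉ , z∼v = good ε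
      in v , ∼⇒∈V (∼-sym z∼v) , v∉ ,
         transferComponents GS (G - v) (_∈ S) (λ c → c) componentMeets (nonTrivial v∉)
           (Apex.separated z∈ good v∉ z∼v) comps
      where
      pick : ∀ {x y} → x ∈ S → y ∈ S → ¬ x ≈ y → ∃ λ z → z ∈ S × Good z
      pick x∈ y∈ x≉y with good-≉ x∈ y∈ x≉y
      ... | inj₁ gx = _ , x∈ , gx
      ... | inj₂ gy = _ , y∈ , gy

      -- The matching edge at `z` avoids `v` and so survives the deletion.
      nonTrivial : ∀ {v z} → v ∉ S → z ∈ S →
        IsComponent (G - v) (component (G - v) z) × NonTrivial (G - v) (component (G - v) z)
      nonTrivial {v} {z} v∉ z∈ =
        let y , m = mate M z∈
            e = ∼-delete G (≢-sym (≉S v∉ z∈)) (≢-sym (≉S v∉ (mates-∈ʳ m)))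
                  (mates-∼ G matching m)
        in component-isComponent (G - v) (Graph.∼⇒∈V (G - v) e) ,
           z , y , ∈-component⁺ (G - v) ε , ∈-component⁺ (G - v) (e ◅ ε) , e

-- Matching numbers and the two directions.

matching-undelete : (G : Graph n) → ∀ {v M} → IsMatching (G - v) M → IsMatching G M
matching-undelete G (edges , disjoint) = All.map (proj₂ ∘ proj₂) edges , disjoint

matching-delete : (G : Graph n) → ∀ {v M} → Fresh v M → IsMatching G M → IsMatching (G - v) M
matching-delete G f (edges , disjoint) =
  All.zipWith (λ ((p , q) , e) → ∼-delete G (≢-sym p) (≢-sym q) e) (f , edges) , disjoint

ν-delete-≤ : (G : Graph n) → ∀ v → ν (G - v) ≤ ν G
ν-delete-≤ G v =
  let M , eq , m = proj₁ (ν-isGreatest (G - v)) in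
  proj₂ (ν-isGreatest G) _ (M , eq , matching-undelete G m)

νd-≤-ν : (G : Graph n) → ∀ c → νd G c ≤ ν G
νd-≤-ν G c =
  let M , eq , m , _ = proj₁ (νd-isGreatest G c) in proj₂ (ν-isGreatest G) _ (M , eq , m)

ν-positive : (G : Graph n) → HasEdge G → 1 ≤ ν G
ν-positive G (u , v , u∼v) =
  proj₂ (ν-isGreatest G) 1 ((u , v) ∷ [] , refl , matching-∷ G u∼v [] [] ([] , []))

maximumDisconnected : (G : Graph n) → ∀ {v j} M → IsMatching (G - v) M →
  (∀ N → IsMatching (G - v) N → length N ≤ length M) →
  AtLeast j (λ C → IsComponent (G - v) C × NonTrivial (G - v) C) →
  AtLeast j (IsComponent (G [ endpoints M ]))
maximumDisconnected G {v} M matching maximum =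
  transferComponents (G - v) (G [ S ]) (_∈ S) proj₁ nonTrivial-meets
    (λ z∈ → component-isComponent (G [ S ])
      (x∈p∩q⁺ (Graph.∼⇒∈V G (proj₂ (proj₂ (edge z∈))) , z∈)))
    -- The matching edge at a vertex of `S` lies in `G - v`, so its first component shows that the
    -- vertex is not `v`.
    (λ _ _ → Star.map λ (x∈ , y∈ , x∼y) → proj₁ (edge x∈) , proj₁ (edge y∈) , x∼y)
  where
  open MaximumMatching (G - v) M matching maximum
  edge : ∀ {z} (z∈ : z ∈ S) → Graph._∼_ (G - v) z (proj₁ (mate M z∈))
  edge z∈ = mates-∼ (G - v) matching (proj₂ (mate M z∈))

SeparatingVertex : Graph n → ℕ → Fin n → Set
SeparatingVertex G j v = v ∈ Graph.V G ×
  AtLeast j (λ C → IsComponent (G - v) C × NonTrivial (G - v) C) × ν G ≡ ν (G - v)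

-- The equality makes a largest `j`-disconnected matching `M` maximum in `G`. The vertex found is
-- uncovered by `M`, so `M` survives in `G - v` and the matching number does not drop.
νd⇒separatingVertex : (G : Graph n) → HasEdge G → DiameterAtMost 3 G → ∀ {j} → 2 ≤ j →
  ν G ≡ νd G j → ∃ (SeparatingVertex G j)
νd⇒separatingVertex G edge diameter {j} 2≤j ν≡νd =
  fromMatching (proj₁ (νd-isGreatest G j))
  where
  fromMatching : HasDisconnectedMatching G j (νd G j) → ∃ (SeparatingVertex G j)
  -- The empty matching is `j`-disconnected by convention; an edge of `G` rules it out.
  fromMatching (_ , size , _ , inj₁ refl) =
    contradiction (ℕ.≤-trans (ν-positive G edge) (ℕ.≤-reflexive (trans ν≡νd (sym size)))) λ ()
  fromMatching (M , size , matching , inj₂ comps) =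
    let v , v∈V , v∉ , comps′ = MaximumMatching.separatingVertex G M matching
          (λ N m → ℕ.≤-trans (proj₂ (ν-isGreatest G) _ (N , refl , m))
                             (ℕ.≤-reflexive (trans ν≡νd (sym size))))
          diameter 2≤j comps
    in v , v∈V , comps′ ,
       ℕ.≤-antisym
         (proj₂ (ν-isGreatest (G - v)) _
           (M , trans size (sym ν≡νd) , matching-delete G (fresh M v∉) matching))
         (ν-delete-≤ G v)

-- A maximum matching of `G - v` has size `ν G` and is `j`-disconnected by `maximumDisconnected`.
separatingVertex⇒νd : (G : Graph n) → ∀ {j} → ∃ (SeparatingVertex G j) → ν G ≡ νd G j
separatingVertex⇒νd G {j} (v , _ , comps , ν≡) =
  ℕ.≤-antisym (fromMatching (proj₁ (ν-isGreatest (G - v)))) (νd-≤-ν G j)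
  where
  fromMatching : HasMatching (G - v) (ν (G - v)) → ν G ≤ νd G j
  fromMatching (M , size , matching) = proj₂ (νd-isGreatest G j) _
    (M , trans size (sym ν≡) , matching-undelete G matching ,
     inj₂ (maximumDisconnected G M matching
       (λ N m → ℕ.≤-trans (proj₂ (ν-isGreatest (G - v)) _ (N , refl , m))
                          (ℕ.≤-reflexive (sym size)))
       comps))

lemma15 : ∀ {n : ℕ} (G : Graph n) → HasEdge G → DiameterAtMost 3 G →
    (j : ℕ) → 2 ≤ j →
    (ν G ≡ νd G j) ⇔
    (∃ λ v → v ∈ Graph.V G ×
    AtLeast j (λ C → IsComponent (G - v) C × NonTrivial (G - v) C) ×
    ν G ≡ ν (G - v))
lemma15 G edge diameter j 2≤j =
  mk⇔ (νd⇒separatingVertex G edge diameter 2≤j) (separatingVertex⇒νd G)
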